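{- Let $n \geq 1$, and let $R \subseteq \mathcal{F}^n$ be a cardinality relation. If $R$ is not definable in $(\mathbb{N},<)$ then there exists some unary cardinality relation $R' \subseteq \mathcal{F}$ that is definable in $(\mathbb{N},<,R)$ and not definable in $(\mathbb{N},<)$. Equivalently: a cardinality relation $R$ is definable in $(\mathbb{N},<)$ iff every unary cardinality relation definable in $(\mathbb{N},<,R)$ is definable in $(\mathbb{N},<)$.
   Context: $\mathcal{F}$ denotes the set of finite subsets of $\mathbb{N}$ and $|X|$ the cardinality of $X\in\mathcal{F}$. Definable means definable in weak monadic second-order logic (WMSO): first-order variables range over $\mathbb{N}$, monadic second-order variables range over finite subsets of $\mathbb{N}$, and atomic formulas use membership $x\in X$ and the symbols of the signature (a symbol for a relation $R\subseteq\mathcal{F}^n$ takes $n$ monadic second-order arguments). A relation $S\subseteq\mathcal{F}^k$ is definable in a structure with domain $\mathbb{N}$ if there is a WMSO formula $\varphi(X_1,\dots,X_k)$ over its signature that holds exactly for the tuples of $S$. A relation $R\subseteq \mathcal{F}^n$ ($n\ge 1$) is a cardinality relation if for all $X_1,\dots,X_n,Y_1,\dots,Y_n\in\mathcal{F}$ with $|X_i|=|Y_i|$ for every $i\in\{1,\dots,n\}$, we have $(X_1,\dots,X_n)\in R$ iff $(Y_1,\dots,Y_n)\in R$. It is unary if $n=1$. -}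

module Defs where

open import Level using (0ℓ)
open import Data.Empty using (⊥)
open import Data.Fin.Base using (Fin)
open import Data.List.Fresh using (List#; length)
open import Data.List.Fresh.Membership.Setoid using () renaming (_∈_ to mem)
open import Data.Nat.Base using (ℕ; suc; _<_)
open import Data.Product.Base using (Σ; ∃; _×_)
open import Data.Unit.Base using (⊤)
open import Data.Vec.Base using (Vec; []; _∷_; lookup; map)
open import Function.Bundles using (_⇔_)
open import Relation.Binary.PropositionalEquality.Core using (_≡_)
open import Relation.Binary.PropositionalEquality.Properties using (setoid)
open import Relation.Nullary.Negation.Core using (¬_)
open import Relation.Unary using (Pred)

-- A finite subset of ℕ is represented by its strictly increasing enumeration.
-- This enumeration is unique, so _≡_ on 𝓕 is equality of sets and the length
-- of the list is the number of elements.
𝓕 : Set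
𝓕 = List# ℕ _<_

infix 4 _∈_

_∈_ : ℕ → 𝓕 → Set
x ∈ X = mem (setoid ℕ) x X

∣_∣ : 𝓕 → ℕ
∣ X ∣ = length X

SetRel : ℕ → Set₁
SetRel n = Pred (Vec 𝓕 n) 0ℓ

IsCardinalityRelation : ∀ {n} → SetRel n → Set
IsCardinalityRelation {n} R =
  (Xs Ys : Vec 𝓕 n) →
  (∀ (i : Fin n) → ∣ lookup Xs i ∣ ≡ ∣ lookup Ys i ∣) →
  R Xs ⇔ R Ys

-- The symbols that a signature has in addition to the order on ℕ, which is
-- always present.
record Signature : Set₁ where
  field
    Symbol : Set
    arity  : Symbol → ℕ

open Signature public

-- WMSO formulas with at most m free first-order and k free second-order
-- variables, as de Bruijn indices. The remaining connectives and the universal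
-- quantifiers are the usual classical abbreviations, and x = y abbreviates
-- ¬ (x < y) ∧ ¬ (y < x).
data Formula (σ : Signature) (m k : ℕ) : Set where
  _<′_ : (x y : Fin m) → Formula σ m k
  _∈′_ : (x : Fin m) (X : Fin k) → Formula σ m k
  rel  : (s : Symbol σ) → Vec (Fin k) (arity σ s) → Formula σ m k
  ¬′_  : Formula σ m k → Formula σ m k
  _∧′_ : (φ ψ : Formula σ m k) → Formula σ m k
  ∃₁_  : Formula σ (suc m) k → Formula σ m k
  ∃₂_  : Formula σ m (suc k) → Formula σ m k

record Structure : Set₁ where
  field
    sig    : Signature
    interp : (s : Symbol sig) → SetRel (arity sig s)

open Structure public

Sat : (A : Structure) → ∀ {m k} → Vec ℕ m → Vec 𝓕 k → Formula (sig A) m k → Set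
Sat A xs Xs (x <′ y)   = lookup xs x < lookup xs y
Sat A xs Xs (x ∈′ X)   = lookup xs x ∈ lookup Xs X
Sat A xs Xs (rel s Is) = interp A s (map (lookup Xs) Is)
Sat A xs Xs (¬′ φ)     = ¬ Sat A xs Xs φ
Sat A xs Xs (φ ∧′ ψ)   = Sat A xs Xs φ × Sat A xs Xs ψ
Sat A xs Xs (∃₁ φ)     = Σ ℕ λ x → Sat A (x ∷ xs) Xs φ
Sat A xs Xs (∃₂ φ)     = Σ 𝓕 λ X → Sat A xs (X ∷ Xs) φ

Definable : Structure → ∀ {k} → SetRel k → Set
Definable A {k} S =
  ∃ λ (φ : Formula (sig A) 0 k) → ∀ (Xs : Vec 𝓕 k) → Sat A [] Xs φ ⇔ S Xs

⟨ℕ,<⟩ : Structure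
⟨ℕ,<⟩ .sig .Symbol  = ⊥
⟨ℕ,<⟩ .sig .arity ()
⟨ℕ,<⟩ .interp ()

⟨ℕ,<,_⟩ : ∀ {n} → SetRel n → Structure
⟨ℕ,<,_⟩ {n} R .sig .Symbol  = ⊤
⟨ℕ,<,_⟩ {n} R .sig .arity _ = n
⟨ℕ,<,_⟩ {n} R .interp _     = R

{-# OPTIONS --safe #-}

-- Call two cardinalities i-indistinguishable if they may be exchanged in the
-- i-th argument of R; this relation on (the cardinalities of) sets is definable
-- from R. If all n relations have finite index, then R is a finite Boolean
-- combination of conditions "Xᵢ lies in a given class", so if R is undefinable
-- over (ℕ,<), one of the classes is undefinable too. If some relation has
-- infinite index, then the least representatives of its classes are unbounded,
-- and equality of cardinalities is definable on them. This suffices to define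
-- the greedy sequence t₀ = 0, tⱼ₊₁ = the least representative above 2 tⱼ, whose
-- set of values is infinite but not eventually periodic. By Büchi's translation
-- of formulas into finite automata, it is not definable over (ℕ,<).
module Submission where

open import Defs
open import Level using (0ℓ)
open import Algebra.Properties.CommutativeSemigroup using (xy∙z≈xz∙y)
open import Axiom.ExcludedMiddle using (ExcludedMiddle)
open import Data.Bool.Base using (Bool; true; false; if_then_else_)
open import Data.Fin.Base as Fin using (Fin; zero; suc; toℕ; combine; remQuot; funToFin; finToFun; lift;
  _↑ˡ_; _↑ʳ_)
open import Data.Fin.Properties using (remQuot-combine; finToFun-funToFin; pigeonhole)
import Data.Fin.Properties as Fin
open import Data.List.Fresh using ([]; cons; _#_)
open import Data.List.Fresh.Relation.Unary.Any using (here; there)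
open import Data.Nat.Base hiding (_<′_)
open import Data.Nat.Induction using (<-rec)
open import Data.Nat.Properties
open import Data.Product.Base using (Σ; ∃; _×_; _,_; proj₁; proj₂)
open import Data.Product.Function.NonDependent.Propositional using (_×-⇔_)
open import Data.Sum.Base using (_⊎_; inj₁; inj₂; [_,_]′)
open import Data.Unit.Base using (tt)
open import Data.Vec.Base using (Vec; []; _∷_; lookup; map; replicate; tabulate; tail; _++_; _[_]≔_)
open import Data.Vec.Properties using (lookup-map; lookup-replicate; lookup∘update; lookup∘update′;
  lookup-++ˡ; lookup-++ʳ; map-[]≔; []≔-lookup; tabulate-∘; tabulate-cong; tabulate∘lookup)
open import Function.Base using (_∘_)
open import Function.Bundles using (_⇔_; mk⇔; Equivalence)
open import Function.Construct.Composition using (_⇔-∘_)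
open import Function.Construct.Identity using (⇔-id)
open import Function.Construct.Symmetry using (⇔-sym)
open import Function.Related.TypeIsomorphisms using (¬-cong-⇔)
open import Relation.Binary.Definitions using (tri<; tri≈; tri>)
open import Relation.Binary.PropositionalEquality hiding (J)
open import Relation.Binary.Structures using (IsEquivalence)
open import Relation.Nullary
open import Relation.Nullary.Decidable using (dec-true; dec-false)

open Equivalence using (to; from)

-- Finite sets

infix 4 _⊆_

_⊆_ : 𝓕 → 𝓕 → Set
X ⊆ Y = ∀ {x} → x ∈ X → x ∈ Y

#⇒< : ∀ {x y} (X : 𝓕) → x # X → y ∈ X → x < y
#⇒< (cons _ _ _) (x<z , _) (here refl) = x<z
#⇒< (cons _ X _) (_ , x#X) (there y∈X) = #⇒< X x#X y∈X

<⇒# : ∀ {x} (X : 𝓕) → (∀ {y} → y ∈ X → x < y) → x # X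
<⇒# []           _ = _
<⇒# (cons _ X _) h = h (here refl) , <⇒# X (h ∘ there)

∈-tail : ∀ {x y X} {y#X : y # X} → y < x → x ∈ cons y X y#X → x ∈ X
∈-tail y<y (here refl) = contradiction y<y (<-irrefl refl)
∈-tail _   (there x∈X) = x∈X

⊆-tail : ∀ {x X x#X y Y y#Y} → y < x → cons x X x#X ⊆ cons y Y y#Y → cons x X x#X ⊆ Y
⊆-tail y<x X⊆Y (here refl) = ∈-tail y<x (X⊆Y (here refl))
⊆-tail {X = X} {x#X} y<x X⊆Y (there z∈X) =
  ∈-tail (<-trans y<x (#⇒< X x#X z∈X)) (X⊆Y (there z∈X))

card-mono : ∀ X Y → X ⊆ Y → ∣ X ∣ ≤ ∣ Y ∣
card-mono []             Y              X⊆Y = z≤n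
card-mono (cons x X x#X) []             X⊆Y with () ← X⊆Y (here refl)
card-mono (cons x X x#X) (cons y Y y#Y) X⊆Y with X⊆Y (here refl)
... | here refl = s≤s (card-mono X Y λ z∈X → ∈-tail (#⇒< X x#X z∈X) (X⊆Y (there z∈X)))
... | there x∈Y = m≤n⇒m≤1+n (card-mono (cons x X x#X) Y (⊆-tail (#⇒< Y y#Y x∈Y) X⊆Y))

card-strict : ∀ X Y → X ⊆ Y → ∀ {z} → z ∈ Y → ¬ z ∈ X → ∣ X ∣ < ∣ Y ∣
card-strict []             (cons _ _ _)   X⊆Y z∈Y z∉X = z<s
card-strict (cons x X x#X) []             X⊆Y ()
card-strict (cons x X x#X) (cons y Y y#Y) X⊆Y z∈Y z∉X with X⊆Y (here refl)
... | there x∈Y = s≤s (card-mono (cons x X x#X) Y (⊆-tail (#⇒< Y y#Y x∈Y) X⊆Y))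
card-strict (cons x X x#X) (cons y Y y#Y) X⊆Y (here refl)  z∉X | here refl =
  contradiction (here refl) z∉X
card-strict (cons x X x#X) (cons y Y y#Y) X⊆Y (there z∈Y) z∉X | here refl =
  s≤s (card-strict X Y (λ w∈X → ∈-tail (#⇒< X x#X w∈X) (X⊆Y (there w∈X))) z∈Y (z∉X ∘ there))

card-cong : ∀ X Y → (∀ x → x ∈ X ⇔ x ∈ Y) → ∣ X ∣ ≡ ∣ Y ∣
card-cong X Y X≈Y =
  ≤-antisym (card-mono X Y (λ {x} → X≈Y x .to)) (card-mono Y X (λ {x} → X≈Y x .from))

subset-of-size : ∀ X c → c ≤ ∣ X ∣ → Σ 𝓕 λ Y → Y ⊆ X × ∣ Y ∣ ≡ c
subset-of-size X              zero    _       = [] , (λ ()) , refl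
subset-of-size (cons x X x#X) (suc c) (s≤s c≤) with subset-of-size X c c≤
... | Y , Y⊆X , refl = cons x Y (<⇒# Y λ y∈Y → #⇒< X x#X (Y⊆X y∈Y)) , sub , refl
  where
  sub : ∀ {z} → z ∈ cons x Y _ → z ∈ cons x X x#X
  sub (here z≡x)  = here z≡x
  sub (there z∈Y) = there (Y⊆X z∈Y)

-- Each element moves the lower end `p` past itself, hence by at least one. The hypothesis `p ≤ q`
-- settles the empty set.
card-bounded : ∀ Y {p q} → (∀ {y} → y ∈ Y → p ≤ y × y < q) → p ≤ q → p + ∣ Y ∣ ≤ q
card-bounded []             {p} h p≤q rewrite +-identityʳ p = p≤q
card-bounded (cons y Y y#Y) {p} {q} h p≤q = begin
  p + suc ∣ Y ∣ ≡⟨ +-suc p ∣ Y ∣ ⟩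
  suc p + ∣ Y ∣ ≤⟨ +-monoˡ-≤ ∣ Y ∣ (s≤s (proj₁ (h (here refl)))) ⟩
  suc y + ∣ Y ∣ ≤⟨ card-bounded Y h′ (proj₂ (h (here refl))) ⟩
  q             ∎
  where
  open ≤-Reasoning
  h′ : ∀ {z} → z ∈ Y → suc y ≤ z × z < q
  h′ z∈Y = #⇒< Y y#Y z∈Y , proj₂ (h (there z∈Y))

interval : ∀ p c → Σ 𝓕 λ X → ∣ X ∣ ≡ c × (∀ x → x ∈ X ⇔ (p ≤ x × x < p + c))
interval p zero = [] , refl , λ x →
  mk⇔ (λ ()) λ (p≤x , x<p) → contradiction (≤-trans x<p (≤-reflexive (+-identityʳ p))) (≤⇒≯ p≤x)
interval p (suc c) with interval (suc p) c
... | X , refl , X-spec = cons p X p#X , refl , λ x → mk⇔ (fwd x) (bwd x)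
  where
  p#X : p # X
  p#X = <⇒# X (λ {x} x∈X → proj₁ (X-spec x .to x∈X))
  fwd : ∀ x → x ∈ cons p X p#X → p ≤ x × x < p + suc ∣ X ∣
  fwd x (here refl) = ≤-refl , m<m+n p z<s
  fwd x (there x∈X) rewrite +-suc p ∣ X ∣ =
    <⇒≤ (proj₁ (X-spec x .to x∈X)) , proj₂ (X-spec x .to x∈X)
  bwd : ∀ x → p ≤ x × x < p + suc ∣ X ∣ → x ∈ cons p X p#X
  bwd x (p≤x , x<) rewrite +-suc p ∣ X ∣ with x ≟ p
  ... | yes x≡p = here x≡p
  ... | no  x≢p = there (X-spec x .from (≤∧≢⇒< p≤x (x≢p ∘ sym) , x<))

seg : ℕ → 𝓕
seg n = proj₁ (interval 0 n)

card-seg : ∀ n → ∣ seg n ∣ ≡ n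
card-seg n = proj₁ (proj₂ (interval 0 n))

∈-seg : ∀ n x → x ∈ seg n ⇔ x < n
∈-seg n x = mk⇔ (proj₂ ∘ spec .to) (λ x<n → spec .from (z≤n , x<n))
  where
  spec = proj₂ (proj₂ (interval 0 n)) x

card-initial : ∀ {n} X → (∀ x → x ∈ X ⇔ x < n) → ∣ X ∣ ≡ n
card-initial {n} X X-spec = trans
  (card-cong X (seg n) λ x → mk⇔ (∈-seg n x .from ∘ X-spec x .to) (X-spec x .from ∘ ∈-seg n x .to))
  (card-seg n)

bounded : ∀ X → ∃ λ b → ∀ {x} → x ∈ X → x < b
bounded []           = 0 , λ ()
bounded (cons x X x#X) with bounded X
... | b , X<b = suc x ⊔ b , λ
  { (here refl) → m≤m⊔n (suc x) b
  ; (there y∈X) → ≤-trans (X<b y∈X) (m≤n⊔m (suc x) b) }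

-- Automata

record DFA (A : Set) : Set₁ where
  field
    size   : ℕ
    δ      : Fin size → A → Fin size
    start  : Fin size
    accept : Fin size → Set

open DFA

runFrom : ∀ {A Q : Set} → (Q → A → Q) → Q → (ℕ → A) → ℕ → Q
runFrom next q w zero    = q
runFrom next q w (suc t) = next (runFrom next q w t) (w t)

run : ∀ {A} (D : DFA A) → (ℕ → A) → ℕ → Fin (size D)
run D = runFrom (δ D) (start D)

run-cong : ∀ {A} (D : DFA A) {w v : ℕ → A} t → (∀ p → p < t → w p ≡ v p) → run D w t ≡ run D v t
run-cong D zero    w≈v = refl
run-cong D (suc t) w≈v = cong₂ (δ D) (run-cong D t λ p p<t → w≈v p (m<n⇒m<1+n p<t)) (w≈v t ≤-refl)

-- A finite word is a stream that is eventually blank, so that all tracks of a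
-- word have the same length.
Recognisable : ∀ {A : Set} → A → ((ℕ → A) → Set) → Set₁
Recognisable {A} blank L = Σ (DFA A) λ D →
  ∀ w t → (∀ p → t ≤ p → w p ≡ blank) → L w ⇔ accept D (run D w t)

recognisable-¬ : ∀ {A} {blank : A} {L} → Recognisable blank L → Recognisable blank (λ w → ¬ L w)
recognisable-¬ {A} (D , D-rec) = ¬D , λ w t w-blank → ¬-cong-⇔ (D-rec w t w-blank)
  where
  ¬D : DFA A
  ¬D .size     = size D
  ¬D .δ        = δ D
  ¬D .start    = start D
  ¬D .accept q = ¬ accept D q

recognisable-× : ∀ {A} {blank : A} {L M} → Recognisable blank L → Recognisable blank M →
                 Recognisable blank (λ w → L w × M w)
recognisable-× {A} {L = L} {M} (D , D-rec) (E , E-rec) = DE , λ w t w-blank →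
  subst (λ (p , q) → (L w × M w) ⇔ (accept D p × accept E q)) (sym (run-DE w t))
    (D-rec w t w-blank ×-⇔ E-rec w t w-blank)
  where
  split = remQuot {size D} (size E)
  DE : DFA A
  DE .size = size D * size E
  DE .δ q a = combine (δ D (proj₁ (split q)) a) (δ E (proj₂ (split q)) a)
  DE .start = combine (start D) (start E)
  DE .accept q = accept D (proj₁ (split q)) × accept E (proj₂ (split q))
  run-DE : ∀ w t → split (run DE w t) ≡ (run D w t , run E w t)
  run-DE w zero    = remQuot-combine (start D) (start E)
  run-DE w (suc t) = trans (remQuot-combine _ _)
    (cong (λ (p , q) → δ D p (w t) , δ E q (w t)) (run-DE w t))

-- The first letter on which the verdict d is not 0 decides: 1 accepts, 2 rejects.
FirstHit : ∀ {A : Set} → (A → Fin 3) → (ℕ → A) → Set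
FirstHit d w = ∃ λ p → d (w p) ≡ suc zero × (∀ q → q < p → d (w q) ≡ zero)

-- Three states suffice: `zero` waits, and the first nonzero verdict becomes an absorbing state. As
-- blanks are silent, no hit lies beyond the end of the word.
recognisable-firstHit : ∀ {A} {blank : A} (d : A → Fin 3) → d blank ≡ zero →
                        Recognisable blank (FirstHit d)
recognisable-firstHit {A} d d-blank = D , λ w t w-blank → mk⇔
  (λ (p , hit , silent) → decided w hit silent t (≰⇒> λ t≤p →
    contradiction (trans (sym hit) (trans (cong d (w-blank p t≤p)) d-blank)) λ ()))
  (hit w t)
  where
  next : Fin 3 → A → Fin 3
  next zero    a = d a
  next (suc s) a = suc s
  D : DFA A
  D .size = 3
  D .δ = next
  D .start = zero
  D .accept q = q ≡ suc zero

  undecided : ∀ w t → (∀ q → q < t → d (w q) ≡ zero) → run D w t ≡ zero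
  undecided w zero    silent = refl
  undecided w (suc t) silent rewrite undecided w t (λ q q<t → silent q (m<n⇒m<1+n q<t)) =
    silent t ≤-refl

  decided : ∀ w {p s} → d (w p) ≡ suc s → (∀ q → q < p → d (w q) ≡ zero) →
            ∀ t → p < t → run D w t ≡ suc s
  decided w {p} eq silent (suc t) (s≤s p≤t) with p ≟ t
  ... | yes refl rewrite undecided w t silent = eq
  ... | no  p≢t  rewrite decided w eq silent t (≤∧≢⇒< p≤t p≢t) = refl

  silent-until : ∀ w t → run D w t ≡ zero → ∀ q → q < t → d (w q) ≡ zero
  silent-until w (suc t) eq q (s≤s q≤t) with run D w t in eq′
  ... | zero with q ≟ t
  ...   | yes refl = eq
  ...   | no  q≢t  = silent-until w t eq′ q (≤∧≢⇒< q≤t q≢t)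

  hit : ∀ w t → run D w t ≡ suc zero → FirstHit d w
  hit w (suc t) eq with run D w t in eq′
  ... | zero  = t , eq , silent-until w t eq′
  ... | suc s = hit w t (trans eq′ eq)

-- Formulas and definable relations

module _ {σ : Signature} {m k : ℕ} where

  subF : (X Y : Fin k) → Formula σ m k
  subF X Y = ¬′ (∃₁ ((zero ∈′ X) ∧′ (¬′ (zero ∈′ Y))))

  segF : (x : Fin m) (S : Fin k) → Formula σ m k
  segF x S = (¬′ (∃₁ ((zero ∈′ S) ∧′ (¬′ (zero <′ suc x))))) ∧′
             (¬′ (∃₁ ((zero <′ suc x) ∧′ (¬′ (zero ∈′ S)))))

  betweenF : (p q : Fin m) (Y : Fin k) → Formula σ m k
  betweenF p q Y = ¬′ (∃₁ ((zero ∈′ Y) ∧′ (¬′ ((suc p <′ zero) ∧′ (zero <′ suc q)))))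

  iffF : (φ ψ : Formula σ m k) → Formula σ m k
  iffF φ ψ = (¬′ (φ ∧′ (¬′ ψ))) ∧′ (¬′ (ψ ∧′ (¬′ φ)))

numeralF : ∀ {σ m k} → ℕ → Fin m → Formula σ m k
numeralF zero    x = ¬′ (∃₁ (zero <′ suc x))
numeralF (suc b) x = ∃₁ (numeralF b zero ∧′ ((zero <′ suc x) ∧′
  (¬′ (∃₁ ((suc zero <′ zero) ∧′ (zero <′ suc (suc x)))))))

Σ-cong-⇔ : ∀ {A : Set} {P Q : A → Set} → (∀ x → P x ⇔ Q x) → Σ A P ⇔ Σ A Q
Σ-cong-⇔ P⇔Q = mk⇔ (λ (x , Px) → x , P⇔Q x .to Px) (λ (x , Qx) → x , P⇔Q x .from Qx)

rename : ∀ {m m′ k k′} → (Fin m → Fin m′) → (Fin k → Fin k′) →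
         Formula (sig ⟨ℕ,<⟩) m k → Formula (sig ⟨ℕ,<⟩) m′ k′
rename f g (x <′ y) = f x <′ f y
rename f g (x ∈′ X) = f x ∈′ g X
rename f g (¬′ φ)   = ¬′ rename f g φ
rename f g (φ ∧′ ψ) = rename f g φ ∧′ rename f g ψ
rename f g (∃₁ φ)   = ∃₁ rename (lift 1 f) g φ
rename f g (∃₂ φ)   = ∃₂ rename f (lift 1 g) φ

lookup-lift : ∀ {A : Set} {m m′} {f : Fin m → Fin m′} {xs : Vec A m′} {ys : Vec A m} →
              (∀ i → lookup xs (f i) ≡ lookup ys i) →
              ∀ x i → lookup (x ∷ xs) (lift 1 f i) ≡ lookup (x ∷ ys) i
lookup-lift eq x zero    = refl
lookup-lift eq x (suc i) = eq i

sat-rename : ∀ {m m′ k k′} (f : Fin m → Fin m′) (g : Fin k → Fin k′) φ {xs ys Xs Ys} →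
             (∀ i → lookup xs (f i) ≡ lookup ys i) → (∀ I → lookup Xs (g I) ≡ lookup Ys I) →
             Sat ⟨ℕ,<⟩ xs Xs (rename f g φ) ⇔ Sat ⟨ℕ,<⟩ ys Ys φ
sat-rename f g (x <′ y) eq₁ eq₂ rewrite eq₁ x | eq₁ y = ⇔-id _
sat-rename f g (x ∈′ X) eq₁ eq₂ rewrite eq₁ x | eq₂ X = ⇔-id _
sat-rename f g (¬′ φ)   eq₁ eq₂ = ¬-cong-⇔ (sat-rename f g φ eq₁ eq₂)
sat-rename f g (φ ∧′ ψ) eq₁ eq₂ = sat-rename f g φ eq₁ eq₂ ×-⇔ sat-rename f g ψ eq₁ eq₂
sat-rename f g (∃₁ φ)   eq₁ eq₂ = Σ-cong-⇔ λ x → sat-rename (lift 1 f) g φ (lookup-lift eq₁ x) eq₂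
sat-rename f g (∃₂ φ)   eq₁ eq₂ = Σ-cong-⇔ λ X → sat-rename f (lift 1 g) φ eq₁ (lookup-lift eq₂ X)

module _ {n : ℕ} {R : SetRel n} (R-def : Definable ⟨ℕ,<⟩ R) where

  unfold : ∀ {m k} → Formula (sig ⟨ℕ,<, R ⟩) m k → Formula (sig ⟨ℕ,<⟩) m k
  unfold (x <′ y)   = x <′ y
  unfold (x ∈′ X)   = x ∈′ X
  unfold (rel _ Is) = rename (λ ()) (lookup Is) (proj₁ R-def)
  unfold (¬′ ψ)     = ¬′ unfold ψ
  unfold (ψ ∧′ χ)   = unfold ψ ∧′ unfold χ
  unfold (∃₁ ψ)     = ∃₁ unfold ψ
  unfold (∃₂ ψ)     = ∃₂ unfold ψ

  sat-unfold : ∀ {m k} (ψ : Formula (sig ⟨ℕ,<, R ⟩) m k) {xs Xs} →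
               Sat ⟨ℕ,<⟩ xs Xs (unfold ψ) ⇔ Sat ⟨ℕ,<, R ⟩ xs Xs ψ
  sat-unfold (x <′ y)   = ⇔-id _
  sat-unfold (x ∈′ X)   = ⇔-id _
  sat-unfold (rel _ Is) {xs} {Xs} = proj₂ R-def (map (lookup Xs) Is) ⇔-∘
    sat-rename (λ ()) (lookup Is) (proj₁ R-def) (λ ()) (λ I → sym (lookup-map I (lookup Xs) Is))
  sat-unfold (¬′ ψ)     = ¬-cong-⇔ (sat-unfold ψ)
  sat-unfold (ψ ∧′ χ)   = sat-unfold ψ ×-⇔ sat-unfold χ
  sat-unfold (∃₁ ψ)     = Σ-cong-⇔ λ x → sat-unfold ψ
  sat-unfold (∃₂ ψ)     = Σ-cong-⇔ λ X → sat-unfold ψ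

  -- Each atom for `R` becomes a renamed copy of the formula that defines `R`. This gives the easy
  -- half of the equivalence.
  definable-unfold : ∀ {k} {S : SetRel k} → Definable ⟨ℕ,<, R ⟩ S → Definable ⟨ℕ,<⟩ S
  definable-unfold (ψ , ψ-def) = unfold ψ , λ Xs → ψ-def Xs ⇔-∘ sat-unfold ψ

definable-cong : ∀ {A k} {R S : SetRel k} → (∀ Xs → R Xs ⇔ S Xs) → Definable A R → Definable A S
definable-cong R⇔S (φ , φ-def) = φ , λ Xs → R⇔S Xs ⇔-∘ φ-def Xs

definable-× : ∀ {A k} {R S : SetRel k} → Definable A R → Definable A S →
              Definable A (λ Xs → R Xs × S Xs)
definable-× (φ , φ-def) (ψ , ψ-def) = φ ∧′ ψ , λ Xs → φ-def Xs ×-⇔ ψ-def Xs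

definable-¬ : ∀ {A k} {R : SetRel k} → Definable A R → Definable A (λ Xs → ¬ R Xs)
definable-¬ (φ , φ-def) = ¬′ φ , λ Xs → ¬-cong-⇔ (φ-def Xs)

definable-constant : ∀ {A k} {P : Set} → Dec P → Definable A {k} (λ _ → P)
definable-constant (yes p) = ¬′ (∃₁ (zero <′ zero)) ,
  λ Xs → mk⇔ (λ _ → p) (λ _ (x , x<x) → <-irrefl refl x<x)
definable-constant (no ¬p) = ∃₁ (zero <′ zero) ,
  λ Xs → mk⇔ (λ (x , x<x) → contradiction x<x (<-irrefl refl)) (λ p → contradiction p ¬p)

definable-reindex : ∀ {k k′} {R : SetRel k} (g : Fin k → Fin k′) (h : Vec 𝓕 k′ → Vec 𝓕 k) →
                    (∀ Xs I → lookup Xs (g I) ≡ lookup (h Xs) I) →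
                    Definable ⟨ℕ,<⟩ R → Definable ⟨ℕ,<⟩ (λ Xs → R (h Xs))
definable-reindex g h eq (φ , φ-def) = rename (λ ()) g φ , λ Xs →
  φ-def (h Xs) ⇔-∘ sat-rename (λ ()) g φ (λ ()) (eq Xs)

-- Index zero is bound innermost, so the values of the block stand in front of the old valuation as
-- `Zs ++ Xs`.
existsF : ∀ {σ m k} n → Formula σ m (n + k) → Formula σ m k
existsF zero    φ = φ
existsF (suc n) φ = existsF n (∃₂ φ)

sat-existsF : ∀ A {m k} n (φ : Formula (sig A) m (n + k)) {xs Xs} →
              Sat A xs Xs (existsF n φ) ⇔ (∃ λ (Zs : Vec 𝓕 n) → Sat A xs (Zs ++ Xs) φ)
sat-existsF A zero    φ = mk⇔ (λ s → [] , s) (λ { ([] , s) → s })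
sat-existsF A (suc n) φ =
  mk⇔ (λ (Zs , Z , s) → Z ∷ Zs , s) (λ { (Z ∷ Zs , s) → Zs , Z , s }) ⇔-∘ sat-existsF A n (∃₂ φ)

-- Classical principles: comprehension and least elements

module _ (em : ExcludedMiddle 0ℓ) where

  separate : ∀ (P : ℕ → Set) X → Σ 𝓕 λ Y → ∀ x → x ∈ Y ⇔ (x ∈ X × P x)
  separate P [] = [] , λ x → mk⇔ (λ ()) (λ ())
  separate P (cons y X y#X) with separate P X | em {P y}
  ... | Y , Y-spec | yes Py = cons y Y (<⇒# Y λ {x} x∈Y → #⇒< X y#X (proj₁ (Y-spec x .to x∈Y))) ,
    λ x → mk⇔
    (λ { (here refl) → here refl , Py
       ; (there x∈Y) → there (proj₁ (Y-spec x .to x∈Y)) , proj₂ (Y-spec x .to x∈Y) })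
    (λ { (here refl , _)  → here refl
       ; (there x∈X , Px) → there (Y-spec x .from (x∈X , Px)) })
  ... | Y , Y-spec | no ¬Py = Y , λ x → mk⇔
    (λ x∈Y → there (proj₁ (Y-spec x .to x∈Y)) , proj₂ (Y-spec x .to x∈Y))
    (λ { (here refl , Px) → contradiction Px ¬Py
       ; (there x∈X , Px) → Y-spec x .from (x∈X , Px) })

  comprehension : ∀ (P : ℕ → Set) n → Σ 𝓕 λ Y → ∀ x → x ∈ Y ⇔ (x < n × P x)
  comprehension P n with separate P (seg n)
  ... | Y , Y-spec = Y , λ x → mk⇔
    (λ x∈Y → ∈-seg n x .to (proj₁ (Y-spec x .to x∈Y)) , proj₂ (Y-spec x .to x∈Y))
    (λ (x<n , Px) → Y-spec x .from (∈-seg n x .from x<n , Px))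

  ¬∀⇒∃¬ : ∀ {A : Set} {P : A → Set} → ¬ (∀ x → P x) → ∃ λ x → ¬ P x
  ¬∀⇒∃¬ ¬∀ = decidable-stable em λ ¬∃ → ¬∀ λ x → decidable-stable em λ ¬Px → ¬∃ (x , ¬Px)

  least : (P : ℕ → Set) → ∃ P → ∃ λ q → P q × (∀ r → r < q → ¬ P r)
  least P (n , Pn) = go n n Pn ≤-refl
    where
    go : ∀ fuel n → P n → n ≤ fuel → ∃ λ q → P q × (∀ r → r < q → ¬ P r)
    go zero n Pn n≤0 = n , Pn , λ r r<n → contradiction (≤-trans r<n n≤0) λ ()
    go (suc fuel) n Pn n≤ with em {∃ λ r → r < n × P r}
    ... | yes (r , r<n , Pr) = go fuel r Pr (s≤s⁻¹ (≤-trans r<n n≤))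
    ... | no  none           = n , Pn , λ r r<n Pr → none (r , r<n , Pr)

  -- Subset construction and projection

  Member : ∀ {n} → Fin n → Fin (2 ^ n) → Set
  Member q S = finToFun S q ≡ suc zero

  indicator : ∀ {n} → (Fin n → Set) → Fin n → Fin 2
  indicator P q = if does (em {P q}) then suc zero else zero

  -- The states of a `DFA` form some `Fin`, so a set of states is coded by its characteristic
  -- function, read as a number below `2 ^ n`.
  stateSet : ∀ {n} → (Fin n → Set) → Fin (2 ^ n)
  stateSet P = funToFin (indicator P)

  ∈-stateSet : ∀ {n} (P : Fin n → Set) q → Member q (stateSet P) ⇔ P q
  ∈-stateSet {n} P q rewrite finToFun-funToFin (indicator P) q
    with em {P q}
  ... | yes Pq = mk⇔ (λ _ → Pq) (λ _ → refl)
  ... | no ¬Pq = mk⇔ (λ ()) (λ Pq → contradiction Pq ¬Pq)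

  module _ {A A′ : Set} (blank : A) (blank′ : A′) (ins : Bool → A → A′)
           (ins-blank : ins false blank ≡ blank′) where

    insert : (ℕ → Bool) → (ℕ → A) → ℕ → A′
    insert β w p = ins (β p) (w p)

    -- Existential quantification erases a track. The guessed track `β` has to end, so that the
    -- extended stream is again a finite word; `ins` is left abstract to serve both kinds of
    -- quantifier.
    Project : ((ℕ → A′) → Set) → (ℕ → A) → Set
    Project L w = ∃ λ β → (∃ λ b → ∀ p → b ≤ p → β p ≡ false) × L (insert β w)

    -- The subset construction: `PD` carries all states that `D` can reach under some guess, and
    -- accepts if acceptance is reachable from one of them by guessing on over blanks.
    recognisable-project : ∀ {L} → Recognisable blank′ L → Recognisable blank (Project L)
    recognisable-project {L} (D , D-rec) = PD , λ w t w-blank →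
      mk⇔ (sound w t w-blank) (complete w t w-blank)
      where
      -- The guessed track may extend beyond the word.
      data Live : Fin (size D) → Set where
        now   : ∀ {q} → accept D q → Live q
        later : ∀ {q} b → Live (δ D q (ins b blank)) → Live q

      Successor : Fin (2 ^ size D) → A → Fin (size D) → Set
      Successor S a q = ∃ λ q₀ → ∃ λ b → Member q₀ S × q ≡ δ D q₀ (ins b a)

      PD : DFA A
      PD .size = 2 ^ size D
      PD .δ S a = stateSet (Successor S a)
      PD .start = stateSet (_≡ start D)
      PD .accept S = ∃ λ q → Member q S × Live q

      tracked : ∀ β w t → Member (run D (insert β w) t) (run PD w t)
      tracked β w zero    = ∈-stateSet (_≡ start D) _ .from refl
      tracked β w (suc t) = ∈-stateSet (Successor (run PD w t) (w t)) _ .from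
        (_ , β t , tracked β w t , refl)

      override : (ℕ → Bool) → ℕ → Bool → ℕ → Bool
      override β t b p = if does (p ≟ t) then b else β p

      run-override : ∀ β w t b →
        run D (insert (override β t b) w) (suc t) ≡ δ D (run D (insert β w) t) (ins b (w t))
      run-override β w t b = cong₂ (λ q c → δ D q (ins c (w t)))
        (run-cong D t λ p p<t → cong (λ c → ins c (w p)) (before p p<t)) at
        where
        at : override β t b t ≡ b
        at = cong (if_then b else β t) (dec-true (t ≟ t) refl)
        before : ∀ p → p < t → override β t b p ≡ β p
        before p p<t = cong (if_then b else β p) (dec-false (p ≟ t) (<⇒≢ p<t))

      -- A run up to `t` reads only the positions before `t`, so the bit chosen at `t` can be
      -- written into the earlier guess without disturbing it.
      guess : ∀ w t q → Member q (run PD w t) → ∃ λ β → run D (insert β w) t ≡ q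
      guess w zero    q q∈ = (λ _ → false) , sym (∈-stateSet (_≡ start D) q .to q∈)
      guess w (suc t) q q∈ with ∈-stateSet (Successor (run PD w t) (w t)) q .to q∈
      ... | q₀ , b , q₀∈ , refl with guess w t q₀ q₀∈
      ...   | β , refl = override β t b , run-override β w t b

      live : ∀ β w t → (∀ p → t ≤ p → w p ≡ blank) → ∀ j →
             accept D (run D (insert β w) (t + j)) → Live (run D (insert β w) t)
      live β w t w-blank zero    acc rewrite +-identityʳ t = now acc
      live β w t w-blank (suc j) acc rewrite +-suc t j = later (β t)
        (subst (λ a → Live (δ D (run D (insert β w) t) (ins (β t) a))) (w-blank t ≤-refl)
          (live β w (suc t) (λ p t<p → w-blank p (<⇒≤ t<p)) j acc))

      extend : ∀ w t → (∀ p → t ≤ p → w p ≡ blank) → ∀ β {q} → Live q → run D (insert β w) t ≡ q →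
               ∃ λ β′ → ∃ λ t′ → t ≤ t′ × accept D (run D (insert β′ w) t′)
      extend w t w-blank β (now acc)   refl = β , t , ≤-refl , acc
      extend w t w-blank β (later b l) refl
        with extend w (suc t) (λ p t<p → w-blank p (<⇒≤ t<p)) (override β t b) l
               (trans (run-override β w t b)
                 (cong (λ a → δ D (run D (insert β w) t) (ins b a)) (w-blank t ≤-refl)))
      ... | β′ , t′ , t<t′ , acc = β′ , t′ , <⇒≤ t<t′ , acc

      insert-blank : ∀ β w t → (∀ p → t ≤ p → w p ≡ blank) → (∀ p → t ≤ p → β p ≡ false) →
                     ∀ p → t ≤ p → insert β w p ≡ blank′
      insert-blank β w t w-blank β-false p t≤p rewrite w-blank p t≤p | β-false p t≤p = ins-blank

      sound : ∀ w t → (∀ p → t ≤ p → w p ≡ blank) → Project L w → accept PD (run PD w t)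
      sound w t w-blank (β , (b , β-false) , Lβ) =
        -- At `t + b` both the word and the guessed track have ended, so `D-rec` applies there.
        run D (insert β w) t , tracked β w t , live β w t w-blank b
          (D-rec (insert β w) (t + b)
            (insert-blank β w (t + b) (λ p le → w-blank p (≤-trans (m≤m+n t b) le))
              (λ p le → β-false p (≤-trans (m≤n+m b t) le))) .to Lβ)

      complete : ∀ w t → (∀ p → t ≤ p → w p ≡ blank) → accept PD (run PD w t) → Project L w
      complete w t w-blank (q , q∈ , q-live) with guess w t q q∈
      ... | β , β-run with extend w t w-blank β q-live β-run
      -- The guess `β′` may carry marks after `t′`; cutting it off there gives a finite track with
      -- the same run up to `t′`.
      ...   | β′ , t′ , t≤t′ , acc = γ , (t′ , γ-false) ,
        D-rec (insert γ w) t′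
          (insert-blank γ w t′ (λ p t′≤p → w-blank p (≤-trans t≤t′ t′≤p)) γ-false) .from
          (subst (accept D)
            (run-cong D t′ λ p p<t′ → cong (λ c → ins c (w p)) (sym (γ-true p p<t′))) acc)
        where
        γ : ℕ → Bool
        γ p = if does (p <? t′) then β′ p else false
        γ-true : ∀ p → p < t′ → γ p ≡ β′ p
        γ-true p p<t′ = cong (if_then β′ p else false) (dec-true (p <? t′) p<t′)
        γ-false : ∀ p → t′ ≤ p → γ p ≡ false
        γ-false p t′≤p = cong (if_then β′ p else false) (dec-false (p <? t′) (≤⇒≯ t′≤p))

  -- Translation of formulas into automata

  Letter : ℕ → ℕ → Set
  Letter m k = Vec Bool m × Vec Bool k

  blankLetter : ∀ m k → Letter m k
  blankLetter m k = replicate m false , replicate k false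

  -- A first-order variable denotes the first position marked on its track.
  record Codes {m k} (w : ℕ → Letter m k) (xs : Vec ℕ m) (Xs : Vec 𝓕 k) : Set where
    field
      marked   : ∀ i → lookup (proj₁ (w (lookup xs i))) i ≡ true
      unmarked : ∀ i p → p < lookup xs i → lookup (proj₁ (w p)) i ≡ false
      member   : ∀ J p → lookup (proj₂ (w p)) J ≡ true ⇔ p ∈ lookup Xs J

    mark-≥ : ∀ i p → lookup (proj₁ (w p)) i ≡ true → lookup xs i ≤ p
    mark-≥ i p eq = ≮⇒≥ λ p< → contradiction (trans (sym eq) (unmarked i p p<)) λ ()

    silent-≤ : ∀ i p → (∀ q → q < p → lookup (proj₁ (w q)) i ≡ false) → p ≤ lookup xs i
    silent-≤ i p silent = ≮⇒≥ λ x<p → contradiction (trans (sym (marked i)) (silent _ x<p)) λ ()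

  open Codes

  -- The mark of `y` is inspected first, so a letter that marks both variables rejects: the order is
  -- strict.
  verdict-< : ∀ {m k} (x y : Fin m) → Letter m k → Fin 3
  verdict-< x y (u , _) =
    if lookup u y then suc (suc zero) else if lookup u x then suc zero else zero

  verdict-∈ : ∀ {m k} (x : Fin m) (X : Fin k) → Letter m k → Fin 3
  verdict-∈ x X (u , v) =
    if lookup u x then (if lookup v X then suc zero else suc (suc zero)) else zero

  verdict-nonempty : ∀ {m k} → Letter (suc m) k → Fin 3
  verdict-nonempty (b ∷ _ , _) = if b then suc zero else zero

  firstHit-< : ∀ {m k} (x y : Fin m) {w : ℕ → Letter m k} {xs Xs} → Codes w xs Xs →
               (lookup xs x < lookup xs y) ⇔ FirstHit (verdict-< x y) w
  firstHit-< {m} {k} x y {w} {xs} c = mk⇔ fwd bwd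
    where
    fwd : lookup xs x < lookup xs y → FirstHit (verdict-< x y) w
    fwd x<y = lookup xs x , at , before
      where
      at : verdict-< x y (w (lookup xs x)) ≡ suc zero
      at rewrite unmarked c y _ x<y | marked c x = refl
      before : ∀ q → q < lookup xs x → verdict-< x y (w q) ≡ zero
      before q q<x rewrite unmarked c y q (<-trans q<x x<y) | unmarked c x q q<x = refl
    y-silent : ∀ (a : Letter m k) → verdict-< x y a ≡ zero → lookup (proj₁ a) y ≡ false
    y-silent (u , v) eq with lookup u y
    ... | false = refl
    x-mark : ∀ (a : Letter m k) → verdict-< x y a ≡ suc zero →
             lookup (proj₁ a) y ≡ false × lookup (proj₁ a) x ≡ true
    x-mark (u , v) eq with lookup u y | lookup u x
    ... | false | true = refl , refl
    bwd : FirstHit (verdict-< x y) w → lookup xs x < lookup xs y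
    bwd (p , hit , silent) with x-mark (w p) hit
    ... | y-off , x-on = ≤-trans (s≤s (mark-≥ c x p x-on)) (silent-≤ c y (suc p) y-off-until)
      where
      y-off-until : ∀ q → q < suc p → lookup (proj₁ (w q)) y ≡ false
      y-off-until q q≤p with q ≟ p
      ... | yes refl = y-off
      ... | no  q≢p  = y-silent (w q) (silent q (≤∧≢⇒< (s≤s⁻¹ q≤p) q≢p))

  firstHit-∈ : ∀ {m k} (x : Fin m) (X : Fin k) {w : ℕ → Letter m k} {xs Xs} → Codes w xs Xs →
               (lookup xs x ∈ lookup Xs X) ⇔ FirstHit (verdict-∈ x X) w
  firstHit-∈ {m} {k} x X {w} {xs} {Xs} c = mk⇔ fwd bwd
    where
    fwd : lookup xs x ∈ lookup Xs X → FirstHit (verdict-∈ x X) w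
    fwd x∈X = lookup xs x , at , before
      where
      at : verdict-∈ x X (w (lookup xs x)) ≡ suc zero
      at rewrite marked c x | member c X (lookup xs x) .from x∈X = refl
      before : ∀ q → q < lookup xs x → verdict-∈ x X (w q) ≡ zero
      before q q<x rewrite unmarked c x q q<x = refl
    x-silent : ∀ (a : Letter m k) → verdict-∈ x X a ≡ zero → lookup (proj₁ a) x ≡ false
    x-silent (u , v) eq with lookup u x | lookup v X
    ... | false | _    = refl
    ... | true  | true with () ← eq
    x-mark : ∀ (a : Letter m k) → verdict-∈ x X a ≡ suc zero →
             lookup (proj₁ a) x ≡ true × lookup (proj₂ a) X ≡ true
    x-mark (u , v) eq with lookup u x | lookup v X
    ... | true | true = refl , refl
    bwd : FirstHit (verdict-∈ x X) w → lookup xs x ∈ lookup Xs X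
    bwd (p , hit , silent) with x-mark (w p) hit
    ... | x-on , X-on = subst (_∈ lookup Xs X)
      (≤-antisym (silent-≤ c x p λ q q<p → x-silent (w q) (silent q q<p)) (mark-≥ c x p x-on))
      (member c X p .to X-on)

  insert₁ : ∀ {m k} → Bool → Letter m k → Letter (suc m) k
  insert₁ b (u , v) = b ∷ u , v

  insert₂ : ∀ {m k} → Bool → Letter m k → Letter m (suc k)
  insert₂ b (u , v) = u , b ∷ v

  -- Induction on the formula. Agreement with `L` is claimed only on streams that code a valuation,
  -- so negation is plain complementation, with no need to exclude malformed streams.
  sat-recognisable : ∀ {m k} (φ : Formula (sig ⟨ℕ,<⟩) m k) → ∃ λ (L : (ℕ → Letter m k) → Set) →
    Recognisable (blankLetter m k) L × (∀ {w xs Xs} → Codes w xs Xs → Sat ⟨ℕ,<⟩ xs Xs φ ⇔ L w)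
  sat-recognisable {m} {k} (x <′ y) =
    _ , recognisable-firstHit (verdict-< x y) silent , firstHit-< x y
    where
    silent : verdict-< x y (blankLetter m k) ≡ zero
    silent rewrite lookup-replicate y false | lookup-replicate x false = refl
  sat-recognisable {m} {k} (x ∈′ X) =
    _ , recognisable-firstHit (verdict-∈ x X) silent , firstHit-∈ x X
    where
    silent : verdict-∈ x X (blankLetter m k) ≡ zero
    silent rewrite lookup-replicate x false = refl
  sat-recognisable (¬′ φ) with sat-recognisable φ
  ... | L , L-rec , φ⇔L = _ , recognisable-¬ L-rec , λ c → ¬-cong-⇔ (φ⇔L c)
  sat-recognisable (φ ∧′ ψ) with sat-recognisable φ | sat-recognisable ψ
  ... | L , L-rec , φ⇔L | M , M-rec , ψ⇔M = _ , recognisable-× L-rec M-rec , λ c → φ⇔L c ×-⇔ ψ⇔M c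
  sat-recognisable {m} {k} (∃₁ φ) with sat-recognisable φ
  ... | L , L-rec , φ⇔L = _ ,
    -- The guessed track must be nonempty in order to name a number. Further marks do no harm, since
    -- the variable denotes the first one.
    recognisable-project (blankLetter m k) _ insert₁ refl
      (recognisable-× L-rec (recognisable-firstHit verdict-nonempty refl)) ,
    λ c → mk⇔ (fwd c) (bwd c)
    where
    P : (ℕ → Letter m k) → Set
    P = Project (blankLetter m k) _ insert₁ refl (λ w → L w × FirstHit verdict-nonempty w)
    codes : ∀ {w : ℕ → Letter m k} {xs Xs} → Codes w xs Xs →
            ∀ β x → β x ≡ true → (∀ q → q < x → β q ≡ false) →
            Codes (λ p → insert₁ (β p) (w p)) (x ∷ xs) Xs
    codes c β x β-x β-< .marked zero    = β-x
    codes c β x β-x β-< .marked (suc i) = marked c i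
    codes c β x β-x β-< .unmarked zero    = β-<
    codes c β x β-x β-< .unmarked (suc i) = unmarked c i
    codes c β x β-x β-< .member = member c
    fwd : ∀ {w xs Xs} → Codes w xs Xs → Sat ⟨ℕ,<⟩ xs Xs (∃₁ φ) → P w
    fwd {w} c (x , s) = β , (suc x , λ p → β-≢ p ∘ >⇒≢) ,
      φ⇔L (codes c β x β-x λ q → β-≢ q ∘ <⇒≢) .to s , x , hit ,
      λ q q<x → cong (λ b → if b then suc zero else zero) (β-≢ q (<⇒≢ q<x))
      where
      β : ℕ → Bool
      β p = does (p ≟ x)
      β-x : β x ≡ true
      β-x = dec-true (x ≟ x) refl
      β-≢ : ∀ p → p ≢ x → β p ≡ false
      β-≢ p p≢x = dec-false (p ≟ x) p≢x
      hit : verdict-nonempty (insert₁ (β x) (w x)) ≡ suc zero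
      hit rewrite β-x = refl
    on : ∀ b → (if b then suc zero else zero) ≡ Fin.suc {2} zero → b ≡ true
    on true _ = refl
    on false ()
    off : ∀ b → (if b then Fin.suc {2} zero else zero) ≡ zero → b ≡ false
    off false _ = refl
    off true ()
    bwd : ∀ {w xs Xs} → Codes w xs Xs → P w → Sat ⟨ℕ,<⟩ xs Xs (∃₁ φ)
    bwd c (β , _ , Lβ , x , hit , silent) =
      x , φ⇔L (codes c β x (on (β x) hit) λ q q<x → off (β q) (silent q q<x)) .from Lβ
  sat-recognisable {m} {k} (∃₂ φ) with sat-recognisable φ
  ... | L , L-rec , φ⇔L = _ ,
    recognisable-project (blankLetter m k) _ insert₂ refl L-rec , λ c → mk⇔ (fwd c) (bwd c)
    where
    P : (ℕ → Letter m k) → Set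
    P = Project (blankLetter m k) _ insert₂ refl L
    codes : ∀ {w : ℕ → Letter m k} {xs Xs} → Codes w xs Xs → ∀ β X → (∀ p → β p ≡ true ⇔ p ∈ X) →
            Codes (λ p → insert₂ (β p) (w p)) xs (X ∷ Xs)
    codes c β X β-X .marked   = marked c
    codes c β X β-X .unmarked = unmarked c
    codes c β X β-X .member zero    = β-X
    codes c β X β-X .member (suc J) = member c J
    fwd : ∀ {w xs Xs} → Codes w xs Xs → Sat ⟨ℕ,<⟩ xs Xs (∃₂ φ) → P w
    fwd c (X , s) with bounded X
    ... | b , X<b = β , (b , λ p b≤p → dec-false em λ p∈X → <⇒≱ (X<b p∈X) b≤p) ,
      φ⇔L (codes c β X β-X) .to s
      where
      β : ℕ → Bool
      β p = does (em {p ∈ X})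
      β-X : ∀ p → β p ≡ true ⇔ p ∈ X
      β-X p with em {p ∈ X}
      ... | yes p∈X = mk⇔ (λ _ → p∈X) (λ _ → refl)
      ... | no  p∉X = mk⇔ (λ ()) (λ p∈X → contradiction p∈X p∉X)
    bwd : ∀ {w xs Xs} → Codes w xs Xs → P w → Sat ⟨ℕ,<⟩ xs Xs (∃₂ φ)
    bwd c (β , (b , β-false) , Lβ) with comprehension (λ p → β p ≡ true) b
    ... | X , X-spec = X , φ⇔L (codes c β X λ p → mk⇔
      (λ eq → X-spec p .from
        (≰⇒> (λ b≤p → contradiction (trans (sym eq) (β-false p b≤p)) λ ()) , eq))
      (λ p∈X → proj₂ (X-spec p .to p∈X))) .from Lβ

  -- Eventual periodicity of definable sets of cardinalities

  EventuallyPeriodic : (ℕ → Set) → Set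
  EventuallyPeriodic T = ∃ λ i → ∃ λ d → 0 < d × (∀ a → i ≤ a → T a ⇔ T (a + d))

  -- The initial segment of size `a` is coded by the word of `a` ones, so `T a` depends only on the
  -- state reached after `a` ones. By the pigeonhole principle two of these states, at `i` and `j`,
  -- agree, and from `i` on the run has period `j ∸ i`.
  definable⇒periodic : ∀ (T : ℕ → Set) → Definable ⟨ℕ,<⟩ (λ (Xs : Vec 𝓕 1) → T ∣ lookup Xs zero ∣) →
                       EventuallyPeriodic T
  definable⇒periodic T (φ , φ-def) with sat-recognisable φ
  ... | L , (D , D-rec) , φ⇔L
    with pigeonhole {size D} ≤-refl (λ i → run D (λ _ → [] , true ∷ []) (toℕ i))
  ...   | i , j , i<j , s-i≡s-j = toℕ i , toℕ j ∸ toℕ i , m<n⇒0<n∸m i<j , λ a i≤a →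
    mk⇔ (T⇔ (a + _) .from ∘ subst (accept D) (shift a i≤a) ∘ T⇔ a .to)
        (T⇔ a .from ∘ subst (accept D) (sym (shift a i≤a)) ∘ T⇔ (a + _) .to)
    where
    ones : ℕ → Letter 0 1
    ones _ = [] , true ∷ []
    word : ℕ → ℕ → Letter 0 1
    word a p = [] , does (p <? a) ∷ []
    codes : ∀ a → Codes (word a) [] (seg a ∷ [])
    codes a .marked ()
    codes a .unmarked ()
    codes a .member zero p = mk⇔
      (λ eq → ∈-seg a p .from (decidable-stable (p <? a) λ p≮a →
        contradiction (trans (sym eq) (dec-false (p <? a) p≮a)) λ ()))
      (λ p∈ → dec-true (p <? a) (∈-seg a p .to p∈))
    run-word : ∀ a → run D (word a) a ≡ run D ones a
    run-word a = run-cong D a λ p p<a → cong (λ b → [] , b ∷ []) (dec-true (p <? a) p<a)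
    T⇔ : ∀ a → T a ⇔ accept D (run D ones a)
    T⇔ a = subst₂ (λ b q → T b ⇔ accept D q) (card-seg a) (run-word a)
      (D-rec (word a) a (λ p a≤p → cong (λ b → [] , b ∷ []) (dec-false (p <? a) (≤⇒≯ a≤p)))
        ⇔-∘ (φ⇔L (codes a) ⇔-∘ mk⇔ (φ-def (seg a ∷ []) .from) (φ-def (seg a ∷ []) .to)))
    shift-+ : ∀ c → run D ones (toℕ i + c) ≡ run D ones (toℕ j + c)
    shift-+ zero rewrite +-identityʳ (toℕ i) | +-identityʳ (toℕ j) = s-i≡s-j
    shift-+ (suc c) rewrite +-suc (toℕ i) c | +-suc (toℕ j) c = cong (λ q → δ D q _) (shift-+ c)
    shift : ∀ a → toℕ i ≤ a → run D ones a ≡ run D ones (a + (toℕ j ∸ toℕ i))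
    shift a i≤a = trans (cong (run D ones) (sym (m+[n∸m]≡n i≤a)))
      (trans (shift-+ (a ∸ toℕ i)) (cong (run D ones) eq))
      where
      eq : toℕ j + (a ∸ toℕ i) ≡ a + (toℕ j ∸ toℕ i)
      eq = trans (cong (_+ (a ∸ toℕ i)) (sym (m+[n∸m]≡n (<⇒≤ i<j))))
        (trans (xy∙z≈xz∙y +-commutativeSemigroup (toℕ i) (toℕ j ∸ toℕ i) (a ∸ toℕ i))
          (cong (_+ (toℕ j ∸ toℕ i)) (m+[n∸m]≡n i≤a)))

  -- Meaning of the auxiliary formulas

  dne : ∀ {P : Set} → ¬ ¬ P → P
  dne = decidable-stable em

  module _ (A : Structure) {m k : ℕ} (xs : Vec ℕ m) (Xs : Vec 𝓕 k) where

    sat-segF : ∀ x S → Sat A xs Xs (segF x S) ⇔ (∀ y → y ∈ lookup Xs S ⇔ y < lookup xs x)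
    sat-segF x S = mk⇔
      (λ (S⊆ , ⊆S) y → mk⇔
        (λ y∈S → dne λ y≮x → S⊆ (y , y∈S , y≮x))
        (λ y<x → dne λ y∉S → ⊆S (y , y<x , y∉S)))
      (λ spec →
        (λ (y , y∈S , y≮x) → y≮x (spec y .to y∈S)) ,
        (λ (y , y<x , y∉S) → y∉S (spec y .from y<x)))

    sat-betweenF : ∀ p q Y → Sat A xs Xs (betweenF p q Y) ⇔
                   (∀ {y} → y ∈ lookup Xs Y → lookup xs p < y × y < lookup xs q)
    sat-betweenF p q Y = mk⇔
      (λ h {y} y∈Y → dne λ ¬b → h (y , y∈Y , ¬b))
      (λ h (y , y∈Y , ¬b) → ¬b (h y∈Y))

    sat-iffF : ∀ φ ψ → Sat A xs Xs (iffF φ ψ) ⇔ (Sat A xs Xs φ ⇔ Sat A xs Xs ψ)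
    sat-iffF φ ψ = mk⇔
      (λ (f , g) → mk⇔ (λ s → dne λ ¬t → f (s , ¬t)) (λ t → dne λ ¬s → g (t , ¬s)))
      (λ e → (λ (s , ¬t) → ¬t (e .to s)) , (λ (t , ¬s) → ¬s (e .from t)))

  sat-numeralF : ∀ (A : Structure) {m k} (xs : Vec ℕ m) (Xs : Vec 𝓕 k) b x →
                 Sat A xs Xs (numeralF b x) ⇔ lookup xs x ≡ b
  sat-numeralF A xs Xs zero x = mk⇔
    (λ none → n≤0⇒n≡0 (≮⇒≥ λ 0<x → none (0 , 0<x)))
    (λ eq (y , y<x) → contradiction (subst (y <_) eq y<x) λ ())
  sat-numeralF A xs Xs (suc b) x = mk⇔
    (λ (y , y≡b , y<x , none) → succ (sat-numeralF A (y ∷ xs) Xs b zero .to y≡b) y<x none)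
    (λ eq → b , sat-numeralF A (b ∷ xs) Xs b zero .from refl , ≤-reflexive (sym eq) ,
      λ (z , b<z , z<x) → contradiction (subst (z <_) eq z<x) (≤⇒≯ b<z))
    where
    succ : ∀ {y} → y ≡ b → y < lookup xs x → ¬ (∃ λ z → y < z × z < lookup xs x) →
           lookup xs x ≡ suc b
    succ refl b<x none = ≤-antisym (≮⇒≥ λ b+1<x → none (suc b , ≤-refl , b+1<x)) b<x

  -- Aperiodic sets of cardinalities

  -- Over a structure that defines an equivalence relation E on cardinalities,
  -- equality can be defined on the least representatives of the E-classes.
  module Towers
    (A : Structure) (E : ℕ → ℕ → Set) (E-equiv : IsEquivalence E)
    (eqF : ∀ {m k} → Fin k → Fin k → Formula (sig A) m k)
    (sat-eqF : ∀ {m k} {xs : Vec ℕ m} {Xs : Vec 𝓕 k} X Y →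
               Sat A xs Xs (eqF X Y) ⇔ E ∣ lookup Xs X ∣ ∣ lookup Xs Y ∣)
    where

    open IsEquivalence E-equiv renaming (refl to E-refl; sym to E-sym; trans to E-trans)

    Min : ℕ → Set
    Min a = ∀ b → b < a → ¬ E b a

    min-unique : ∀ {a b} → Min a → Min b → E a b → a ≡ b
    min-unique min-a min-b Eab = ≤-antisym
      (≮⇒≥ λ b<a → min-a _ b<a (E-sym Eab)) (≮⇒≥ λ a<b → min-b _ a<b Eab)

    Next : ℕ → ℕ → Set
    Next p q = Min q × p + p < q × ¬ (∃ λ r → r < q × Min r × p + p < r)

    -- Doubling makes the gaps unbounded, which excludes every period.
    data Tower : ℕ → Set where
      base : Tower 0
      step : ∀ {p q} → Tower p → Next p q → Tower q

    tower-min : ∀ {t} → Tower t → Min t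
    tower-min base       = λ b ()
    tower-min (step _ n) = proj₁ n

    -- Induction on both derivations. Let `p` be the predecessor of `s`. If `t` were strictly
    -- between `p` and `s`, induction would give `p + p < t`, and `s` would not be the least
    -- admissible successor of `p`.
    tower-gap : ∀ {t s} → Tower t → Tower s → t < s → t + t < s
    tower-gap T S = go _ _ T S
      where
      go : ∀ t s → Tower t → Tower s → t < s → t + t < s
      go t s T (step {p} S n@(min-s , 2p<s , least-s)) t<s with <-cmp t p
      ... | tri< t<p _ _ = <-trans (go t p T S t<p) (≤-trans (s≤s (m≤m+n p p)) 2p<s)
      ... | tri≈ _ refl _ = 2p<s
      ... | tri> _ _ p<t = contradiction (t , t<s , tower-min T , go p t S T p<t) least-s

    module _ (unbounded : ∀ B → ∃ λ a → Min a × B < a) where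

      tower-unbounded : ∀ B → ∃ λ t → Tower t × B ≤ t
      tower-unbounded zero = 0 , base , z≤n
      tower-unbounded (suc B) with tower-unbounded B
      ... | t , T , B≤t with least (λ q → Min q × t + t < q) (unbounded (t + t))
      ...   | q , (min-q , 2t<q) , q-least = q ,
        step T (min-q , 2t<q , λ (r , r<q , h) → q-least r r<q h) ,
        ≤-trans (s≤s B≤t) (≤-trans (s≤s (m≤m+n t t)) 2t<q)

      -- For an element `t` beyond `i + d`, a period `d` would put `t + d` into the tower. But
      -- larger elements exceed `t + t`, which is at least `t + d`.
      tower-aperiodic : ¬ EventuallyPeriodic Tower
      tower-aperiodic (i , d , 0<d , periodic) with tower-unbounded (i + d)
      ... | t , T , i+d≤t = <⇒≱
        (tower-gap T (periodic t (≤-trans (m≤m+n i d) i+d≤t) .to T) (m<m+n t 0<d))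
        (+-monoʳ-≤ t (≤-trans (m≤n+m d i) i+d≤t))

    -- Sizes of arbitrary sets cannot be compared directly. Yet every smaller cardinality is that of
    -- a proper subset, and inclusion is definable.
    minF : ∀ {m k} → Fin k → Formula (sig A) m k
    minF S = ¬′ (∃₂ (subF zero (suc S) ∧′ ((¬′ subF (suc S) zero) ∧′ eqF zero (suc S))))

    sat-minF : ∀ {m k} {xs : Vec ℕ m} {Xs : Vec 𝓕 k} S → Sat A xs Xs (minF S) ⇔ Min ∣ lookup Xs S ∣
    sat-minF {Xs = Xs} S = mk⇔ fwd bwd
      where
      fwd : _ → Min ∣ lookup Xs S ∣
      fwd none b b<S Eb with subset-of-size (lookup Xs S) b (<⇒≤ b<S)
      ... | Y , Y⊆S , refl = none (Y , (λ (y , y∈Y , y∉S) → y∉S (Y⊆S y∈Y)) ,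
        (λ S⊆Y → <⇒≱ b<S (card-mono (lookup Xs S) Y λ {y} y∈S → dne λ y∉Y → S⊆Y (y , y∈S , y∉Y))) ,
        sat-eqF zero (suc S) .from Eb)
      bwd : Min ∣ lookup Xs S ∣ → _
      bwd min (Y , Y⊆S , S⊈Y , EY) = S⊈Y λ (y , y∈S , y∉Y) →
        min ∣ Y ∣
          (card-strict Y (lookup Xs S) (λ {y} y∈Y → dne λ y∉S → Y⊆S (y , y∈Y , y∉S)) y∈S y∉Y)
          (sat-eqF zero (suc S) .to EY)

    minF₁ : ∀ {m k} → Fin m → Formula (sig A) m k
    minF₁ x = ∃₂ (segF x zero ∧′ minF zero)

    sat-minF₁ : ∀ {m k} {xs : Vec ℕ m} {Xs : Vec 𝓕 k} x → Sat A xs Xs (minF₁ x) ⇔ Min (lookup xs x)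
    sat-minF₁ {xs = xs} {Xs} x = mk⇔
      (λ (S , S-seg , S-min) →
        subst Min (card-initial S (sat-segF A xs (S ∷ Xs) x zero .to S-seg)) (sat-minF zero .to S-min))
      (λ min → seg (lookup xs x) ,
        sat-segF A xs (seg (lookup xs x) ∷ Xs) x zero .from (∈-seg (lookup xs x)) ,
        sat-minF zero .from (subst Min (sym (card-seg (lookup xs x))) min))

    -- For `p < q`, the inequality `p + p < q` says that at least `p` numbers lie strictly between
    -- `p` and `q`. A set of such numbers with size `E`-equivalent to `p` replaces the addition.
    doubleF : ∀ {m k} → (p q : Fin m) → Formula (sig A) m k
    doubleF p q = (p <′ q) ∧′ (∃₂ (segF p zero ∧′ (∃₂ (betweenF p q zero ∧′ eqF zero (suc zero)))))

    -- As p is a least representative, E ∣ Y ∣ p implies p ≤ ∣ Y ∣.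
    sat-doubleF : ∀ {m k} {xs : Vec ℕ m} {Xs : Vec 𝓕 k} p q → Min (lookup xs p) →
                  Sat A xs Xs (doubleF p q) ⇔ (lookup xs p + lookup xs p < lookup xs q)
    sat-doubleF {xs = xs} {Xs} p q min = mk⇔ fwd bwd
      where
      fwd : _ → lookup xs p + lookup xs p < lookup xs q
      fwd (p<q , S , S-seg , Y , Y-between , EY) = ≤-trans
        (s≤s (+-monoʳ-≤ (lookup xs p) (≮⇒≥ λ Y<p → min ∣ Y ∣ Y<p
          (subst (E ∣ Y ∣) (card-initial S (sat-segF A xs (S ∷ Xs) p zero .to S-seg))
            (sat-eqF zero (suc zero) .to EY)))))
        (card-bounded Y (sat-betweenF A xs (Y ∷ S ∷ Xs) p q zero .to Y-between) p<q)
      bwd : lookup xs p + lookup xs p < lookup xs q → _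
      bwd 2p<q with interval (suc (lookup xs p)) (lookup xs p)
      ... | Y , |Y|≡p , Y-spec = ≤-trans (s≤s (m≤m+n _ _)) 2p<q ,
        S , sat-segF A xs (S ∷ Xs) p zero .from (∈-seg (lookup xs p)) ,
        Y , sat-betweenF A xs (Y ∷ S ∷ Xs) p q zero .from
              (λ {y} y∈Y → proj₁ (Y-spec y .to y∈Y) , ≤-trans (proj₂ (Y-spec y .to y∈Y)) 2p<q) ,
        sat-eqF zero (suc zero) .from (subst₂ E (sym |Y|≡p) (sym (card-seg (lookup xs p))) E-refl)
        where
        S : 𝓕
        S = seg (lookup xs p)

    nextF : ∀ {m k} → (p q : Fin m) → Formula (sig A) m k
    nextF p q = minF₁ q ∧′ (doubleF p q ∧′
      (¬′ (∃₁ ((zero <′ suc q) ∧′ (minF₁ zero ∧′ doubleF (suc p) zero)))))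

    sat-nextF : ∀ {m k} {xs : Vec ℕ m} {Xs : Vec 𝓕 k} p q → Min (lookup xs p) →
                Sat A xs Xs (nextF p q) ⇔ Next (lookup xs p) (lookup xs q)
    sat-nextF p q min = mk⇔
      (λ (q-min , 2p<q , none) → sat-minF₁ q .to q-min , sat-doubleF p q min .to 2p<q ,
        λ (r , r<q , r-min , 2p<r) → none
          (r , r<q , sat-minF₁ zero .from r-min , sat-doubleF (suc p) zero min .from 2p<r))
      (λ (q-min , 2p<q , none) → sat-minF₁ q .from q-min , sat-doubleF p q min .from 2p<q ,
        λ (r , r<q , r-min , 2p<r) → none
          (r , r<q , sat-minF₁ zero .to r-min , sat-doubleF (suc p) zero min .to 2p<r))

    closedF : ∀ {m k} → Fin k → Formula (sig A) m k
    closedF P = ¬′ (∃₁ ((zero ∈′ P) ∧′ ((¬′ numeralF 0 zero) ∧′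
                 (¬′ (∃₁ ((zero ∈′ P) ∧′ nextF zero (suc zero)))))))

    -- Membership in the inductive set Tower is witnessed by a finite set in which
    -- every nonzero element has its predecessor in the tower.
    towerF : Formula (sig A) 0 1
    towerF = minF zero ∧′ (∃₁ (∃₂ (segF zero zero ∧′ (eqF zero (suc zero) ∧′
               (∃₂ ((zero ∈′ zero) ∧′ closedF zero))))))

    closed⇒tower : ∀ {m k} {xs : Vec ℕ m} {Xs : Vec 𝓕 k} P → Sat A xs Xs (closedF P) →
                   ∀ p → p ∈ lookup Xs P → Tower p
    closed⇒tower {xs = xs} {Xs} P closed = <-rec _ λ p rec p∈P → dne λ ¬T → closed (p , p∈P ,
      (λ p≡0 → ¬T (subst Tower (sym (sat-numeralF A (p ∷ xs) Xs 0 zero .to p≡0)) base)) ,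
      -- The inequality `p′ < p` is read off the formula itself: `sat-nextF` needs `Min` of `p′`,
      -- which is known only after the induction hypothesis has been applied.
      (λ (p′ , p′∈P , n) → let T′ = rec (proj₁ (proj₁ (proj₂ n))) p′∈P in
        ¬T (step T′ (sat-nextF zero (suc zero) (tower-min T′) .to n))))

    tower-definable : Definable A (λ (Xs : Vec 𝓕 1) → Tower ∣ lookup Xs zero ∣)
    tower-definable = towerF , λ { (X ∷ []) → mk⇔ (fwd X) (bwd X) }
      where
      fwd : ∀ X → Sat A [] (X ∷ []) towerF → Tower ∣ X ∣
      fwd X (X-min , t , S , S-seg , ES , P , t∈P , closed) = subst Tower
        -- The formula only makes `t` and `∣ X ∣` equivalent; as both are least representatives,
        -- they are equal.
        (min-unique (tower-min T) (sat-minF zero .to X-min)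
          (subst (λ s → E s ∣ X ∣)
            (card-initial S (sat-segF A (t ∷ []) (S ∷ X ∷ []) zero zero .to S-seg))
            (sat-eqF zero (suc zero) .to ES)))
        T
        where
        T : Tower t
        T = closed⇒tower zero closed t t∈P
      bwd : ∀ X → Tower ∣ X ∣ → Sat A [] (X ∷ []) towerF
      -- The witness is the whole tower up to `∣ X ∣`, which is closed because predecessors are
      -- smaller.
      bwd X T with comprehension Tower (suc ∣ X ∣)
      ... | P , P-spec = sat-minF zero .from (tower-min T) ,
        ∣ X ∣ , seg ∣ X ∣ ,
        sat-segF A (∣ X ∣ ∷ []) (seg ∣ X ∣ ∷ X ∷ []) zero zero .from (∈-seg ∣ X ∣) ,
        sat-eqF zero (suc zero) .from (subst (λ s → E s ∣ X ∣) (sym (card-seg ∣ X ∣)) E-refl) ,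
        P , P-spec ∣ X ∣ .from (≤-refl , T) , closed
        where
        closed : Sat A (∣ X ∣ ∷ []) (P ∷ seg ∣ X ∣ ∷ X ∷ []) (closedF zero)
        closed (p , p∈P , p≢0 , none) with P-spec p .to p∈P
        ... | _    , base =
          p≢0 (sat-numeralF A (0 ∷ ∣ X ∣ ∷ []) (P ∷ seg ∣ X ∣ ∷ X ∷ []) 0 zero .from refl)
        ... | p≤X , step {p′} T′ n@(_ , 2p′<p , _) = none (p′ ,
          P-spec p′ .from (<-trans (≤-trans (s≤s (m≤m+n p′ p′)) 2p′<p) p≤X , T′) ,
          sat-nextF zero (suc zero) (tower-min T′) .from n)

  -- Relations determined by finitely many definable classes

  definable-⊎ : ∀ {A k} {R S : SetRel k} → Definable A R → Definable A S →
                Definable A (λ Xs → R Xs ⊎ S Xs)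
  definable-⊎ {R = R} {S} R-def S-def = definable-cong
    (λ Xs → mk⇔
      (λ h → dne λ ¬R⊎S → h (¬R⊎S ∘ inj₁ , ¬R⊎S ∘ inj₂))
      (λ R⊎S (¬R , ¬S) → [ ¬R , ¬S ]′ R⊎S))
    (definable-¬ (definable-× (definable-¬ R-def) (definable-¬ S-def)))

  definable-⋁ : ∀ {A k} {R : ℕ → SetRel k} B → (∀ b → Definable A (R b)) →
                Definable A (λ Xs → ∃ λ b → b ≤ B × R b Xs)
  definable-⋁ zero    R-def = definable-cong
    (λ Xs → mk⇔ (λ r → 0 , z≤n , r) (λ { (.0 , z≤n , r) → r })) (R-def 0)
  definable-⋁ {R = R} (suc B) R-def = definable-cong (λ Xs → mk⇔ (fwd Xs) (bwd Xs))
    (definable-⊎ (R-def (suc B)) (definable-⋁ B R-def))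
    where
    fwd : ∀ Xs → (R (suc B) Xs ⊎ ∃ λ b → b ≤ B × R b Xs) → ∃ λ b → b ≤ suc B × R b Xs
    fwd Xs (inj₁ r)           = suc B , ≤-refl , r
    fwd Xs (inj₂ (b , b≤ , r)) = b , m≤n⇒m≤1+n b≤ , r
    bwd : ∀ Xs → (∃ λ b → b ≤ suc B × R b Xs) → R (suc B) Xs ⊎ ∃ λ b → b ≤ B × R b Xs
    bwd Xs (b , b≤ , r) with b ≟ suc B
    ... | yes refl = inj₁ r
    ... | no  b≢   = inj₂ (b , s≤s⁻¹ (≤∧≢⇒< b≤ b≢) , r)

  -- Finitely many definable classes per coordinate suffice: the first argument
  -- may be replaced by the representative of its class, which leaves a relation
  -- of smaller arity.
  definable-by-classes : ∀ n (R : SetRel n) (C : Fin n → ℕ → SetRel 1)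
    (rep : ℕ → 𝓕) (B : Fin n → ℕ) →
    (∀ i X → ∃ λ b → b ≤ B i × C i b (X ∷ [])) →
    (∀ i b → Definable ⟨ℕ,<⟩ (C i b)) →
    (∀ i b Xs → C i b (lookup Xs i ∷ []) → R Xs ⇔ R (Xs [ i ]≔ rep b)) →
    Definable ⟨ℕ,<⟩ R
  definable-by-classes zero    R C rep B cover C-def respects =
    definable-cong (λ { [] → ⇔-id _ }) (definable-constant em)
  definable-by-classes (suc n) R C rep B cover C-def respects = definable-cong
    (λ { (X ∷ Xs) → mk⇔
      (λ (b , _ , c , r) → respects zero b (X ∷ Xs) c .from r)
      (λ r → let (b , b≤ , c) = cover zero X in b , b≤ , c , respects zero b (X ∷ Xs) c .to r) })
    (definable-⋁ {R = λ b Xs → C zero b (lookup Xs zero ∷ []) × R (rep b ∷ tail Xs)}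
      (B zero) λ b → definable-×
      (definable-reindex (λ _ → zero) (λ Xs → lookup Xs zero ∷ []) (λ { Xs zero → refl })
        (C-def zero b))
      (definable-reindex suc tail (λ { (X ∷ Xs) I → refl })
        (definable-by-classes n (λ Xs → R (rep b ∷ Xs)) (C ∘ suc) rep (B ∘ suc)
          (cover ∘ suc) (C-def ∘ suc)
          (λ i c Xs → respects (suc i) c (rep b ∷ Xs)))))

  -- Indistinguishable cardinalities

  module _ {n} (R : SetRel n) (R-card : IsCardinalityRelation R) where

    Indistinguishable : Fin n → ℕ → ℕ → Set
    Indistinguishable i a b = ∀ Zs → R (Zs [ i ]≔ seg a) ⇔ R (Zs [ i ]≔ seg b)

    indistinguishable-equiv : ∀ i → IsEquivalence (Indistinguishable i)
    indistinguishable-equiv i = record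
      { refl  = λ {a} Zs → ⇔-id (R (Zs [ i ]≔ seg a))
      ; sym   = λ a~b Zs → ⇔-sym (a~b Zs)
      ; trans = λ a~b b~c Zs → b~c Zs ⇔-∘ a~b Zs
      }

    replace : ∀ i Zs X → R (Zs [ i ]≔ X) ⇔ R (Zs [ i ]≔ seg ∣ X ∣)
    replace i Zs X = R-card _ _ same
      where
      same : ∀ j → ∣ lookup (Zs [ i ]≔ X) j ∣ ≡ ∣ lookup (Zs [ i ]≔ seg ∣ X ∣) j ∣
      same j with j Fin.≟ i
      ... | yes refl rewrite lookup∘update j Zs X | lookup∘update j Zs (seg ∣ X ∣) =
        sym (card-seg ∣ X ∣)
      ... | no  j≢i  rewrite lookup∘update′ j≢i Zs X | lookup∘update′ j≢i Zs (seg ∣ X ∣) = refl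

    -- The first `n` indices stand for the tuple that `existsF` binds; its `i`-th entry is
    -- overwritten by `X`, shifted past the block.
    replaceF : ∀ {m k} → Fin n → Fin k → Formula (sig ⟨ℕ,<, R ⟩) m (n + k)
    replaceF {k = k} i X = rel tt (tabulate (_↑ˡ k) [ i ]≔ (n ↑ʳ X))

    map-replace : ∀ {k} i (X : Fin k) (Zs : Vec 𝓕 n) (Xs : Vec 𝓕 k) →
                  map (lookup (Zs ++ Xs)) (tabulate (_↑ˡ k) [ i ]≔ (n ↑ʳ X)) ≡ Zs [ i ]≔ lookup Xs X
    map-replace {k} i X Zs Xs = trans (map-[]≔ (lookup (Zs ++ Xs)) (tabulate (_↑ˡ k)) i)
      (cong₂ (_[ i ]≔_)
        (trans (sym (tabulate-∘ (lookup (Zs ++ Xs)) (_↑ˡ k)))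
          (trans (tabulate-cong (lookup-++ˡ Zs Xs)) (tabulate∘lookup Zs)))
        (lookup-++ʳ Zs Xs X))

    indistinguishableF : ∀ {m k} → Fin n → Fin k → Fin k → Formula (sig ⟨ℕ,<, R ⟩) m k
    indistinguishableF i X Y = ¬′ existsF n (¬′ iffF (replaceF i X) (replaceF i Y))

    sat-indistinguishableF : ∀ i {m k} {xs : Vec ℕ m} {Xs : Vec 𝓕 k} X Y →
      Sat ⟨ℕ,<, R ⟩ xs Xs (indistinguishableF i X Y) ⇔
      Indistinguishable i ∣ lookup Xs X ∣ ∣ lookup Xs Y ∣
    sat-indistinguishableF i {m} {xs = xs} {Xs} X Y = mk⇔
      (λ none Zs → pointwise Zs .to (dne λ ¬s → none (sat-existsF _ n _ .from (Zs , ¬s))))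
      (λ X~Y ex → let (Zs , ¬s) = sat-existsF _ n _ .to ex in ¬s (pointwise Zs .from (X~Y Zs)))
      where
      A = ⟨ℕ,<, R ⟩
      sat-replaceF : ∀ Zs X → Sat A xs (Zs ++ Xs) (replaceF i X) ⇔ R (Zs [ i ]≔ seg ∣ lookup Xs X ∣)
      sat-replaceF Zs X rewrite map-replace i X Zs Xs = replace i Zs (lookup Xs X)
      pointwise : ∀ Zs → Sat A xs (Zs ++ Xs) (iffF (replaceF i X) (replaceF i Y)) ⇔
                  (R (Zs [ i ]≔ seg ∣ lookup Xs X ∣) ⇔ R (Zs [ i ]≔ seg ∣ lookup Xs Y ∣))
      pointwise Zs = mk⇔
        (λ e → sat-replaceF Zs Y ⇔-∘ (e ⇔-∘ ⇔-sym (sat-replaceF Zs X)))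
        (λ e → ⇔-sym (sat-replaceF Zs Y) ⇔-∘ (e ⇔-∘ sat-replaceF Zs X))
        ⇔-∘ sat-iffF A xs (Zs ++ Xs) (replaceF i X) (replaceF i Y)

    Class : Fin n → ℕ → SetRel 1
    Class i b Xs = Indistinguishable i b ∣ lookup Xs zero ∣

    -- The representative `b` is a fixed number, so `numeralF` names it without parameters, and its
    -- initial segment is a set of that size.
    class-definable : ∀ i b → Definable ⟨ℕ,<, R ⟩ (Class i b)
    class-definable i b =
      ∃₁ (numeralF b zero ∧′ (∃₂ (segF zero zero ∧′ indistinguishableF i zero (suc zero)))) ,
      λ Xs → mk⇔
        (λ (x , x≡b , S , S-seg , S~X) → subst (λ c → Indistinguishable i c ∣ lookup Xs zero ∣)
          (trans (card-initial S (sat-segF A (x ∷ []) (S ∷ Xs) zero zero .to S-seg))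
                 (sat-numeralF A (x ∷ []) Xs b zero .to x≡b))
          (sat-indistinguishableF i zero (suc zero) .to S~X))
        (λ b~X → b , sat-numeralF A (b ∷ []) Xs b zero .from refl , seg b ,
          sat-segF A (b ∷ []) (seg b ∷ Xs) zero zero .from (∈-seg b) ,
          sat-indistinguishableF i zero (suc zero) .from
            (subst (λ c → Indistinguishable i c ∣ lookup Xs zero ∣) (sym (card-seg b)) b~X))
      where
      A = ⟨ℕ,<, R ⟩

    cardinality-relation : ∀ (T : ℕ → Set) →
                           IsCardinalityRelation (λ (Xs : Vec 𝓕 1) → T ∣ lookup Xs zero ∣)
    cardinality-relation T Xs Ys same = mk⇔ (subst T (same zero)) (subst T (sym (same zero)))

    -- Finite and infinite index

    Witness : Set₁
    Witness = ∃ λ (R′ : SetRel 1) →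
      IsCardinalityRelation R′ × Definable ⟨ℕ,<, R ⟩ R′ × (¬ Definable ⟨ℕ,<⟩ R′)

    -- Finite index is expressed by a bound on representatives, the form in which
    -- `definable-by-classes` takes a disjunction over classes.
    FiniteIndex : Fin n → Set
    FiniteIndex i = ∃ λ B → ∀ a → ∃ λ b → b ≤ B × Indistinguishable i b a

    module _ (i : Fin n) where

      open IsEquivalence (indistinguishable-equiv i) using ()
        renaming (refl to ~-refl; trans to ~-trans)
      open Towers ⟨ℕ,<, R ⟩ (Indistinguishable i) (indistinguishable-equiv i)
                  (indistinguishableF i) (sat-indistinguishableF i)

      -- Some `a` is indistinguishable from nothing up to `B`, so the least element of its class
      -- lies above `B`.
      representatives-unbounded : ¬ FiniteIndex i → ∀ B → ∃ λ a → Min a × B < a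
      representatives-unbounded infinite B with ¬∀⇒∃¬ (λ all → infinite (B , all))
      ... | a , a-new with least (λ c → Indistinguishable i c a) (a , ~-refl {a})
      ...   | c , c~a , c-least = c ,
        (λ b b<c b~c → c-least b b<c (~-trans {b} {c} {a} b~c c~a)) ,
        ≰⇒> λ c≤B → a-new (c , c≤B , c~a)

      infiniteIndex⇒witness : ¬ FiniteIndex i → Witness
      infiniteIndex⇒witness infinite = (λ Xs → Tower ∣ lookup Xs zero ∣) ,
        cardinality-relation Tower , tower-definable ,
        λ T-def → tower-aperiodic (representatives-unbounded infinite)
          (definable⇒periodic Tower T-def)

    undefinable⇒witness : ¬ Definable ⟨ℕ,<⟩ R → Witness
    undefinable⇒witness R-undef
      with em {∀ i → FiniteIndex i} | em {∀ i b → Definable ⟨ℕ,<⟩ (Class i b)}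
    ... | no ¬finite | _ with ¬∀⇒∃¬ ¬finite
    ...   | i , infinite = infiniteIndex⇒witness i infinite
    undefinable⇒witness R-undef | yes finite | no ¬def with ¬∀⇒∃¬ ¬def
    ...   | i , ¬def-i with ¬∀⇒∃¬ ¬def-i
    ...     | b , undef =
      Class i b , cardinality-relation (Indistinguishable i b) , class-definable i b , undef
    undefinable⇒witness R-undef | yes finite | yes def = contradiction
      (definable-by-classes n R Class seg (λ i → proj₁ (finite i))
        (λ i X → proj₂ (finite i) ∣ X ∣) def
        -- Overwriting the `i`-th entry of `Xs` by itself changes nothing, so `replace` leads to the
        -- segment of the same size, and indistinguishability from there to `seg b`.
        λ i b Xs b~X → ⇔-sym (b~X Xs) ⇔-∘
          subst (λ Zs → R Zs ⇔ R (Xs [ i ]≔ seg ∣ lookup Xs i ∣)) ([]≔-lookup Xs i)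
            (replace i Xs (lookup Xs i)))
      R-undef

theorem3p4 : ExcludedMiddle 0ℓ →
    ∀ (n : ℕ) → 1 ≤ n → (R : SetRel n) → IsCardinalityRelation R →
    (¬ Definable ⟨ℕ,<⟩ R →
    ∃ λ (R′ : SetRel 1) →
    IsCardinalityRelation R′ ×
    Definable ⟨ℕ,<, R ⟩ R′ ×
    (¬ Definable ⟨ℕ,<⟩ R′))
    ×
    (Definable ⟨ℕ,<⟩ R ⇔
    (∀ (R′ : SetRel 1) → IsCardinalityRelation R′ →
    Definable ⟨ℕ,<, R ⟩ R′ → Definable ⟨ℕ,<⟩ R′))
theorem3p4 em n _ R R-card = witness , mk⇔
  (λ R-def R′ _ → definable-unfold R-def)
  (λ all-def → decidable-stable em λ R-undef →
    let (R′ , R′-card , R′-def , R′-undef) = witness R-undef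
    in R′-undef (all-def R′ R′-card R′-def))
  where
  witness = undefinable⇒witness em R R-card
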